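{- Let $G$ be a graph with independence number $\alpha(G)=2$ whose edges are colored with two colors. Then $G$ has a $(4,4)$-cover; that is, $V(G)$ can be covered by the vertex sets of two monochromatic subgraphs of $G$, each of diameter at most $4$. Equivalently, $f(2,2)\le 4$.
   Context: Graphs are finite and simple. A 2-colored graph is a graph in which each edge is assigned one of two colors. A monochromatic subgraph is a subgraph (not necessarily induced) all of whose edges have the same color; a single vertex counts as a monochromatic subgraph. The diameter of a graph $H$ is the smallest integer $d$ with $d_H(u,v)\le d$ for all $u,v\in V(H)$, where $d_H(u,v)$ is the length of a shortest path from $u$ to $v$ in $H$ itself ($\infty$ if there is none); a one-vertex graph has diameter $0$. A 2-colored graph $G$ has a $(p,q)$-cover if $V(G)$ is the union of the vertex sets of two monochromatic subgraphs of $G$, one of diameter at most $p$ and the other of diameter at most $q$; the two subgraphs may have the same or different colors and their vertex sets may overlap. $f(r,\alpha)$ denotes the least $d$ such that for every graph $G$ with $\alpha(G)=\alpha$ and every $r$-edge-coloring of $G$, $V(G)$ can be covered by the vertex sets of $(r-1)\alpha$ monochromatic connected subgraphs, each of diameter at most $d$. -}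

module Defs where

open import Data.Nat.Base using (ℕ; zero; suc; _≤_; _*_; _∸_)
open import Data.Fin.Base using (Fin)
open import Data.Fin.Subset using (Subset; _∈_; ∣_∣; Nonempty)
open import Data.List.Base using (List; []; _∷_)
open import Data.List.Relation.Unary.Unique.Propositional using (Unique)
open import Data.Product.Base using (Σ; ∃; ∃-syntax; _×_)
open import Data.Sum.Base using (_⊎_)
open import Level using (0ℓ)
open import Relation.Binary.Core using (Rel)
open import Relation.Binary.Definitions using (Symmetric; Irreflexive; Decidable)
open import Relation.Binary.PropositionalEquality.Core using (_≡_)
open import Relation.Nullary.Negation.Core using (¬_)

-- Adjacency is required to be decidable, as it always is for a finite graph
-- given as finite data.
record Graph (n : ℕ) : Set₁ where
  field
    Adj    : Rel (Fin n) 0ℓ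
    adj?   : Decidable Adj
    sym    : Symmetric Adj
    irrefl : Irreflexive _≡_ Adj

open Graph public using (Adj)

module _ {n : ℕ} (G : Graph n) where

  Independent : Subset n → Set
  Independent S = ∀ {u v} → u ∈ S → v ∈ S → ¬ Adj G u v

  IndependenceNumber : ℕ → Set
  IndependenceNumber α =
    (∃[ S ] Independent S × ∣ S ∣ ≡ α) × (∀ S → Independent S → ∣ S ∣ ≤ α)

  -- `colour-sym` quantifies over arbitrary adjacency proofs, so the colour
  -- depends only on the unordered pair {u , v}: using it twice shows that it
  -- does not depend on the proof of `Adj G u v`.
  record Colouring (r : ℕ) : Set where
    field
      colour     : ∀ {u v} → Adj G u v → Fin r
      colour-sym : ∀ {u v} (e : Adj G u v) (e′ : Adj G v u) → colour e ≡ colour e′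

  -- Not necessarily induced, and never empty.
  record Subgraph : Set₁ where
    field
      V        : Subset n
      nonempty : Nonempty V
      E        : Rel (Fin n) 0ℓ
      E?       : Decidable E
      E-sym    : Symmetric E
      E⊆Adj    : ∀ {u v} → E u v → Adj G u v
      E⊆V      : ∀ {u v} → E u v → u ∈ V

open Colouring public using (colour)
open Subgraph public using (V; E; E⊆Adj)

module _ {n : ℕ} {G : Graph n} (H : Subgraph G) where

  data Walk : Fin n → Fin n → ℕ → Set where
    nil  : ∀ {u} → u ∈ V H → Walk u u zero
    cons : ∀ {u v w k} → E H u v → Walk v w k → Walk u w (suc k)

  vertices : ∀ {u v k} → Walk u v k → List (Fin n)
  vertices (nil {u} _)    = u ∷ []
  vertices (cons {u} _ w) = u ∷ vertices w

  Path : Fin n → Fin n → ℕ → Set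
  Path u v k = Σ (Walk u v k) λ w → Unique (vertices w)

  -- `Distance u v k` says that d_H(u , v) is finite and equal to k; an infinite
  -- distance is represented by there being no such k.
  Distance : Fin n → Fin n → ℕ → Set
  Distance u v k = Path u v k × (∀ l → Path u v l → k ≤ l)

  DistancesAtMost : ℕ → Set
  DistancesAtMost d =
    ∀ {u v} → u ∈ V H → v ∈ V H → ∃[ k ] Distance u v k × k ≤ d

  Diameter : ℕ → Set
  Diameter d = DistancesAtMost d × (∀ e → DistancesAtMost e → d ≤ e)

  DiameterAtMost : ℕ → Set
  DiameterAtMost d = ∃[ k ] Diameter k × k ≤ d

  -- `Subgraph` already excludes the empty graph.
  Connected : Set
  Connected = ∀ {u v} → u ∈ V H → v ∈ V H → ∃[ k ] Path u v k

module _ {n : ℕ} {G : Graph n} {r : ℕ} (c : Colouring G r) where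

  Monochromatic : Subgraph G → Set
  Monochromatic H = ∀ {u v x y} (e : E H u v) (e′ : E H x y) →
    colour c (E⊆Adj H e) ≡ colour c (E⊆Adj H e′)

  HasCover : ℕ → ℕ → Set₁
  HasCover p q = ∃[ H₁ ] ∃[ H₂ ]
      (Monochromatic H₁ × DiameterAtMost H₁ p)
    × (Monochromatic H₂ × DiameterAtMost H₂ q)
    × (∀ v → v ∈ V H₁ ⊎ v ∈ V H₂)

  HasConnectedCover : ℕ → ℕ → Set₁
  HasConnectedCover m d = Σ (Fin m → Subgraph G) λ H →
      (∀ i → Monochromatic (H i) × Connected (H i) × DiameterAtMost (H i) d)
    × (∀ v → ∃[ i ] v ∈ V (H i))

CoverBound : ℕ → ℕ → ℕ → Set₁
CoverBound r α d = ∀ {n} (G : Graph n) → IndependenceNumber G α →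
  (c : Colouring G r) → HasConnectedCover c ((r ∸ 1) * α) d

-- The graph of the partial function f: `IsF r α d` says that f(r , α) = d.
IsF : ℕ → ℕ → ℕ → Set₁
IsF r α d = CoverBound r α d × (∀ e → CoverBound r α e → d ≤ e)

-- f(r , α) ≤ b.  `CoverBound r α` quantifies over all finite graphs and is not
-- decidable a priori, so an upper bound does not constructively produce the
-- least value; hence the double negation, which is classically redundant.
F≤ : ℕ → ℕ → ℕ → Set₁
F≤ r α b = ¬ ¬ (∃[ d ] IsF r α d × d ≤ b)

-- Write B_i(x) for the set of vertices at distance at most 2 from x in colour
-- i ∈ {red, blue}; it spans a monochromatic subgraph of diameter at most 4, so
-- it suffices to cover the vertices by two such balls.  Fix x and suppose that
-- the two balls around x leave out z, that the two red balls around x and z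
-- leave out w, and that the two blue balls around x and z leave out w′.  As
-- α = 2, every vertex off a non-edge is adjacent to one of its ends.  From this
-- one sees that, up to exchanging x and z, the complement contains the 4-cycle
-- x z w w′, where xw is blue and zw′ is red.  Then every further vertex u is
-- adjacent to both x and w, or to both z and w′.  In the first case, u cannot
-- be red to both, so it is in the blue ball around x; in the second case, it
-- is likewise in the red ball around z.  Hence these two balls cover.

module Submission where

open import Defs
open import Data.Fin.Base using (Fin; zero; suc)
open import Data.Fin.Properties using (_≟_; any?; all?)
open import Data.Fin.Subset using (Subset; _∈_; ⁅_⁆; _∪_; ∣_∣; _⊂_)
open import Data.Fin.Subset.Properties
  using (_∈?_; x∈⁅x⁆; x∈⁅y⁆⇒x≡y; ∣⁅x⁆∣≡1; p⊂q⇒∣p∣<∣q∣; p⊆p∪q; q⊆p∪q; x∈p∪q⁻)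
open import Data.List.Relation.Unary.All using ([])
open import Data.List.Relation.Unary.All.Properties using (¬Any⇒All¬)
open import Data.List.Relation.Unary.AllPairs using ([]; _∷_)
open import Data.List.Relation.Unary.Any using (here; there)
import Data.List.Membership.Propositional as List
open import Data.List.Relation.Unary.Unique.Propositional using (Unique)
open import Data.Nat.Base using (ℕ; zero; suc; _+_; _≤_; _<_; z≤n; s≤s; s≤s⁻¹)
open import Data.Nat.Induction using (<-rec)
open import Data.Nat.Properties
  using (anyUpTo?; ≮⇒≥; ≤-trans; ≤-reflexive; <-irrefl; n≤1+n; +-mono-≤)
open import Data.Product.Base using (∃-syntax; _×_; _,_; proj₁; proj₂)
open import Data.Sum.Base using (_⊎_; inj₁; inj₂; [_,_]; [_,_]′)
open import Data.Vec.Base using ([]; tabulate)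
open import Data.Vec.Properties using (lookup∘tabulate; []=⇒lookup; lookup⇒[]=)
open import Function.Base using (id; _∘_)
open import Level using (0ℓ)
open import Relation.Binary.PropositionalEquality using (_≡_; _≢_; refl; trans)
import Relation.Binary.PropositionalEquality as ≡
open import Relation.Nullary.Decidable
  using (Dec; yes; no; does; dec-true; map′; _×-dec_; _⊎-dec_; _→-dec_; ¬?; decidable-stable)
open import Relation.Nullary.Negation using (¬_; contradiction)
open import Relation.Unary using (Pred; Decidable)

-- Least elements of predicates on the natural numbers.

module _ {ℓ} (P : Pred ℕ ℓ) where

  Least : Set ℓ
  Least = ∃[ m ] P m × (∀ k → P k → m ≤ k)

  least : Decidable P → ∀ m → P m → Least
  least P? = <-rec (λ m → P m → Least) step
    where
    step : ∀ m → (∀ {k} → k < m → P k → Least) → P m → Least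
    step m rec pm with anyUpTo? P? m
    ... | yes (k , k<m , pk) = rec k<m pk
    ... | no ∄k<m = m , pm , λ k pk → ≮⇒≥ λ k<m → ∄k<m (k , k<m , pk)

  -- This version serves the undecidable `CoverBound`: if no least element existed, strong induction
  -- would refute `P` everywhere.
  ¬¬least : ∀ m → P m → ¬ ¬ Least
  ¬¬least m pm ¬least = <-rec (λ k → ¬ P k) step m pm
    where
    step : ∀ k → (∀ {l} → l < k → ¬ P l) → ¬ P k
    step k rec pk = ¬least (k , pk , λ l pl → ≮⇒≥ λ l<k → rec l<k pl)

-- Subsets cut out by decidable predicates.

module _ {n : ℕ} {P : Pred (Fin n) 0ℓ} (P? : Decidable P) where

  comprehension : Subset n
  comprehension = tabulate (does ∘ P?)

  ∈-comprehension⁺ : ∀ {v} → P v → v ∈ comprehension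
  ∈-comprehension⁺ {v} pv =
    lookup⇒[]= v _ (trans (lookup∘tabulate (does ∘ P?) v) (dec-true (P? v) pv))

  ∈-comprehension⁻ : ∀ {v} → v ∈ comprehension → P v
  ∈-comprehension⁻ {v} v∈
    with P? v | trans (≡.sym (lookup∘tabulate (does ∘ P?) v)) ([]=⇒lookup v∈)
  ... | yes pv | _ = pv
  ... | no _   | ()

-- Walks, distances and diameters in a subgraph.

module _ {n : ℕ} {G : Graph n} (H : Subgraph G) where
  open Subgraph H using (E?; E-sym; E⊆V)

  walk? : ∀ u v k → Dec (Walk H u v k)
  walk? u v zero = map′ (λ { (refl , u∈V) → nil u∈V }) (λ { (nil u∈V) → refl , u∈V })
    (u ≟ v ×-dec u ∈? V H)
  walk? u v (suc k) = map′ (λ { (_ , e , w) → cons e w }) (λ { (cons e w) → _ , e , w })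
    (any? λ x → E? u x ×-dec walk? x v k)

  suffix : ∀ {u v x k} (w : Walk H u v k) → x List.∈ vertices H w →
    ∃[ l ] l ≤ k × Walk H x v l
  suffix w@(nil _)    (here refl) = _ , z≤n , w
  suffix w@(cons _ _) (here refl) = _ , ≤-reflexive refl , w
  suffix (cons _ w)   (there x∈w) with suffix w x∈w
  ... | l , l≤k , w′ = l , ≤-trans l≤k (n≤1+n _) , w′

  -- If the first vertex recurred, the suffix from its recurrence would be a shorter walk with the
  -- same ends. Tails of shortest walks are again shortest, so the argument recurses.
  shortest⇒unique : ∀ {u v k} (w : Walk H u v k) → (∀ l → Walk H u v l → k ≤ l) →
    Unique (vertices H w)
  shortest⇒unique (nil _) _ = [] ∷ []
  shortest⇒unique (cons e w) shortest =
    ¬Any⇒All¬ _ u∉w ∷ shortest⇒unique w (λ l w′ → s≤s⁻¹ (shortest (suc l) (cons e w′)))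
    where
    u∉w : ¬ _ List.∈ vertices H w
    u∉w u∈w with suffix w u∈w
    ... | l , l≤k , w′ = <-irrefl refl (≤-trans (shortest l w′) l≤k)

  walk⇒distance : ∀ {u v k} → Walk H u v k → ∃[ l ] Distance H u v l × l ≤ k
  walk⇒distance {u} {v} {k} w with least (Walk H u v) (walk? u v) k w
  ... | l , w′ , shortest =
    l , ((w′ , shortest⇒unique w′ shortest) , λ m → shortest m ∘ proj₁) , shortest k w

  -- A decidable equivalent of `DistancesAtMost`, which lets `least` find the exact diameter. The
  -- bound is written `k < suc d` to fit the search by `anyUpTo?`.
  WalksAtMost : ℕ → Set
  WalksAtMost d = ∀ u v → u ∈ V H → v ∈ V H → ∃[ k ] k < suc d × Walk H u v k

  walksAtMost? : Decidable WalksAtMost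
  walksAtMost? d = all? λ u → all? λ v →
    u ∈? V H →-dec v ∈? V H →-dec anyUpTo? (walk? u v) (suc d)

  walks⇒distances : ∀ {d} → WalksAtMost d → DistancesAtMost H d
  walks⇒distances walks {u} {v} u∈V v∈V with walks u v u∈V v∈V
  ... | k , k≤d , w with walk⇒distance w
  ... | l , dist , l≤k = l , dist , ≤-trans l≤k (s≤s⁻¹ k≤d)

  distances⇒walks : ∀ {d} → DistancesAtMost H d → WalksAtMost d
  distances⇒walks dists u v u∈V v∈V with dists u∈V v∈V
  ... | k , ((w , _) , _) , k≤d = k , s≤s k≤d , w

  walks⇒diameter : ∀ {d} → WalksAtMost d → DiameterAtMost H d
  walks⇒diameter {d} walks with least WalksAtMost walksAtMost? d walks
  ... | k , walks′ , minimal =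
    k , (walks⇒distances walks′ , λ e dists → minimal e (distances⇒walks dists)) ,
    minimal d walks

  diameter⇒connected : ∀ {d} → DiameterAtMost H d → Connected H
  diameter⇒connected (_ , (dists , _) , _) u∈V v∈V with dists u∈V v∈V
  ... | k , (path , _) , _ = k , path

  infixr 5 _++_
  _++_ : ∀ {u v w k l} → Walk H u v k → Walk H v w l → Walk H u w (k + l)
  nil _    ++ w′ = w′
  cons e w ++ w′ = cons e (w ++ w′)

  -- Any two vertices are joined through the centre `x`. Walks to and from `x` are both supplied, so
  -- that none has to be reversed.
  radius⇒diameter : ∀ {r} x →
    (∀ {v} → v ∈ V H → (∃[ k ] k ≤ r × Walk H v x k) × (∃[ k ] k ≤ r × Walk H x v k)) →
    DiameterAtMost H (r + r)
  radius⇒diameter x walks = walks⇒diameter λ u v u∈V v∈V →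
    let k , k≤r , w  = proj₁ (walks u∈V)
        l , l≤r , w′ = proj₂ (walks v∈V)
    in k + l , s≤s (+-mono-≤ k≤r l≤r) , w ++ w′

-- Balls of radius 2 in one colour.

module _ {n : ℕ} {G : Graph n} {r : ℕ} (c : Colouring G r) where
  open Graph G using (adj?) renaming (sym to Adj-sym)
  open Colouring c using (colour-sym)

  Edge : Fin r → Fin n → Fin n → Set
  Edge i u v = ∃[ e ] colour c {u} {v} e ≡ i

  edge? : ∀ i u v → Dec (Edge i u v)
  edge? i u v with adj? u v
  ... | no ¬e = no (¬e ∘ proj₁)
  ... | yes e with colour c e ≟ i
  ...   | yes e≡i = yes (e , e≡i)
  ...   | no e≢i = no λ (e′ , e′≡i) → e≢i
    -- Two proofs of the same adjacency get the same colour because both agree with the reversed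
    -- edge.
    (trans (colour-sym e (Adj-sym e)) (trans (≡.sym (colour-sym e′ (Adj-sym e))) e′≡i))

  edge-sym : ∀ {i u v} → Edge i u v → Edge i v u
  edge-sym (e , e≡i) = Adj-sym e , trans (colour-sym (Adj-sym e) e) e≡i

  Near : Fin r → Fin n → Fin n → Set
  Near i x v = x ≡ v ⊎ Edge i x v ⊎ ∃[ y ] Edge i x y × Edge i y v

  near-sym : ∀ {i x v} → Near i x v → Near i v x
  near-sym (inj₁ x≡v)                 = inj₁ (≡.sym x≡v)
  near-sym (inj₂ (inj₁ e))            = inj₂ (inj₁ (edge-sym e))
  near-sym (inj₂ (inj₂ (y , e , e′))) = inj₂ (inj₂ (y , edge-sym e′ , edge-sym e))

  near? : ∀ i x → Decidable (Near i x)
  near? i x v = x ≟ v ⊎-dec edge? i x v ⊎-dec any? λ y → edge? i x y ×-dec edge? i y v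

  module _ (i : Fin r) (x : Fin n) where

    ball : Subgraph G
    ball = record
      { V        = B
      ; nonempty = x , ∈-comprehension⁺ (near? i x) (inj₁ refl)
      ; E        = λ u v → Edge i u v × u ∈ B × v ∈ B
      ; E?       = λ u v → edge? i u v ×-dec u ∈? B ×-dec v ∈? B
      ; E-sym    = λ (e , u∈B , v∈B) → edge-sym e , v∈B , u∈B
      ; E⊆Adj    = proj₁ ∘ proj₁
      ; E⊆V      = proj₁ ∘ proj₂
      }
      where B = comprehension (near? i x)

    ball-monochromatic : Monochromatic c ball
    ball-monochromatic ((_ , e≡i) , _) ((_ , e′≡i) , _) = trans e≡i (≡.sym e′≡i)

    ∈-ball : ∀ {v} → Near i x v → v ∈ V ball
    ∈-ball = ∈-comprehension⁺ (near? i x)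

    ball-diameter : DiameterAtMost ball 4
    ball-diameter = radius⇒diameter ball x
      λ v∈B → walks v∈B (∈-comprehension⁻ (near? i x) v∈B)
      where
      x∈B : x ∈ V ball
      x∈B = ∈-ball (inj₁ refl)

      walks : ∀ {v} → v ∈ V ball → Near i x v →
        (∃[ k ] k ≤ 2 × Walk ball v x k) × (∃[ k ] k ≤ 2 × Walk ball x v k)
      walks v∈B (inj₁ refl) = (0 , z≤n , nil x∈B) , (0 , z≤n , nil x∈B)
      walks v∈B (inj₂ (inj₁ e)) =
        (1 , s≤s z≤n , cons (edge-sym e , v∈B , x∈B) (nil x∈B)) ,
        (1 , s≤s z≤n , cons (e , x∈B , v∈B) (nil v∈B))
      walks v∈B (inj₂ (inj₂ (y , e , e′))) =
        (2 , s≤s (s≤s z≤n) ,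
         cons (edge-sym e′ , v∈B , y∈B) (cons (edge-sym e , y∈B , x∈B) (nil x∈B))) ,
        (2 , s≤s (s≤s z≤n) , cons (e , x∈B , y∈B) (cons (e′ , y∈B , v∈B) (nil v∈B)))
        where
        -- The midpoint is a neighbour of the centre, so the whole path stays inside the ball.
        y∈B : y ∈ V ball
        y∈B = ∈-ball (inj₂ (inj₁ e))

  Covers : Fin r → Fin n → Fin r → Fin n → Set
  Covers i x j y = ∀ v → Near i x v ⊎ Near j y v

  covers⊎missed : ∀ i x j y → Covers i x j y ⊎ ∃[ v ] ¬ Near i x v × ¬ Near j y v
  covers⊎missed i x j y with any? (λ v → ¬? (near? i x v) ×-dec ¬? (near? j y v))
  ... | yes missed = inj₂ missed
  ... | no ∄missed = inj₁ λ v →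
    decidable-stable (near? i x v ⊎-dec near? j y v)
      λ ¬near → ∄missed (v , ¬near ∘ inj₁ , ¬near ∘ inj₂)

  covers⇒hasCover : ∀ {i x j y} → Covers i x j y → HasCover c 4 4
  covers⇒hasCover {i} {x} {j} {y} covers =
    ball i x , ball j y ,
    (ball-monochromatic i x , ball-diameter i x) ,
    (ball-monochromatic j y , ball-diameter j y) ,
    [ inj₁ ∘ ∈-ball i x , inj₂ ∘ ∈-ball j y ] ∘ covers

-- Adjacency in graphs of independence number at most 2.

module _ {n : ℕ} {G : Graph n} (α≤2 : ∀ S → Independent G S → ∣ S ∣ ≤ 2) where
  open Graph G using (adj?; irrefl) renaming (sym to Adj-sym)

  -- Otherwise `a`, `b`, `u` would form an independent set of size 3. Its size is bounded below by a
  -- chain of strict inclusions starting at `⁅ a ⁆`.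
  nonEdge⇒adjacent : ∀ {a b u} → ¬ Adj G a b → a ≢ b → a ≢ u → b ≢ u →
    ¬ Adj G a u → Adj G b u
  nonEdge⇒adjacent {a} {b} {u} a≁b a≢b a≢u b≢u a≁u =
    decidable-stable (adj? b u) λ b≁u → <-irrefl refl (≤-trans 3≤∣abu∣ (α≤2 abu (abu-indep b≁u)))
    where
    ab abu : Subset n
    ab = ⁅ a ⁆ ∪ ⁅ b ⁆
    abu = ab ∪ ⁅ u ⁆

    ∈-ab : ∀ {v} → v ∈ ab → v ≡ a ⊎ v ≡ b
    ∈-ab v∈ = [ inj₁ ∘ x∈⁅y⁆⇒x≡y a , inj₂ ∘ x∈⁅y⁆⇒x≡y b ] (x∈p∪q⁻ ⁅ a ⁆ ⁅ b ⁆ v∈)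

    ∈-abu : ∀ {v} → v ∈ abu → v ≡ a ⊎ v ≡ b ⊎ v ≡ u
    ∈-abu v∈ with x∈p∪q⁻ ab ⁅ u ⁆ v∈
    ... | inj₂ v∈u = inj₂ (inj₂ (x∈⁅y⁆⇒x≡y u v∈u))
    ... | inj₁ v∈ab with ∈-ab v∈ab
    ...   | inj₁ v≡a = inj₁ v≡a
    ...   | inj₂ v≡b = inj₂ (inj₁ v≡b)

    a⊂ab : ⁅ a ⁆ ⊂ ab
    a⊂ab = p⊆p∪q ⁅ b ⁆ , b , q⊆p∪q ⁅ a ⁆ ⁅ b ⁆ (x∈⁅x⁆ b) ,
      λ b∈a → a≢b (≡.sym (x∈⁅y⁆⇒x≡y a b∈a))

    ab⊂abu : ab ⊂ abu
    ab⊂abu = p⊆p∪q ⁅ u ⁆ , u , q⊆p∪q ab ⁅ u ⁆ (x∈⁅x⁆ u) ,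
      λ u∈ab → [ a≢u ∘ ≡.sym , b≢u ∘ ≡.sym ] (∈-ab u∈ab)

    3≤∣abu∣ : 3 ≤ ∣ abu ∣
    3≤∣abu∣ = ≤-trans
      (s≤s (≤-trans (s≤s (≤-reflexive (≡.sym (∣⁅x⁆∣≡1 a)))) (p⊂q⇒∣p∣<∣q∣ a⊂ab)))
      (p⊂q⇒∣p∣<∣q∣ ab⊂abu)

    abu-indep : ¬ Adj G b u → Independent G abu
    abu-indep b≁u v∈ w∈ with ∈-abu v∈ | ∈-abu w∈
    ... | inj₁ refl        | inj₁ refl        = irrefl refl
    ... | inj₁ refl        | inj₂ (inj₁ refl) = a≁b
    ... | inj₁ refl        | inj₂ (inj₂ refl) = a≁u
    ... | inj₂ (inj₁ refl) | inj₁ refl        = a≁b ∘ Adj-sym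
    ... | inj₂ (inj₁ refl) | inj₂ (inj₁ refl) = irrefl refl
    ... | inj₂ (inj₁ refl) | inj₂ (inj₂ refl) = b≁u
    ... | inj₂ (inj₂ refl) | inj₁ refl        = a≁u ∘ Adj-sym
    ... | inj₂ (inj₂ refl) | inj₂ (inj₁ refl) = b≁u ∘ Adj-sym
    ... | inj₂ (inj₂ refl) | inj₂ (inj₂ refl) = irrefl refl

  -- Covering by two balls.

  module _ (c : Colouring G 2) where

    private
      pattern red  = zero
      pattern blue = suc zero

    red⊎blue : ∀ {u v} → Adj G u v → Edge c red u v ⊎ Edge c blue u v
    red⊎blue e with colour c e in eq
    ... | red  = inj₁ (e , eq)
    ... | blue = inj₂ (e , eq)

    near-edge : ∀ {i x v} → Edge c i x v → Near c i x v
    near-edge = inj₂ ∘ inj₁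

    near-path : ∀ {i x y v} → Edge c i x y → Edge c i y v → Near c i x v
    near-path e e′ = inj₂ (inj₂ (_ , e , e′))

    far⇒nonEdge : ∀ {x v} → ¬ Near c red x v → ¬ Near c blue x v → ¬ Adj G x v
    far⇒nonEdge ¬r ¬b = [ ¬r ∘ near-edge , ¬b ∘ near-edge ] ∘ red⊎blue

    blue-edge : ∀ {x v} → ¬ Near c red x v → Adj G x v → Edge c blue x v
    blue-edge ¬r e = [ (λ e′ → contradiction (near-edge e′) ¬r) , id ] (red⊎blue e)

    red-edge : ∀ {x v} → ¬ Near c blue x v → Adj G x v → Edge c red x v
    red-edge ¬b e = [ id , (λ e′ → contradiction (near-edge e′) ¬b) ] (red⊎blue e)

    cycle⇒covers : ∀ {x z w w′} →
      ¬ Adj G x z → ¬ Adj G z w → ¬ Adj G w w′ → ¬ Adj G w′ x → x ≢ z →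
      Edge c blue x w → Edge c red z w′ →
      ¬ Near c red x w → ¬ Near c red z w → ¬ Near c blue x w′ → ¬ Near c blue z w′ →
      Covers c blue x red z
    cycle⇒covers {x} {z} {w} {w′} x≁z z≁w w≁w′ w′≁x x≢z xw zw′ ¬rxw ¬rzw ¬bxw′ ¬bzw′ u
      with near? c blue x u | near? c red z u
    ... | yes near | _ = inj₁ near
    ... | no _ | yes near = inj₂ near
    ... | no ¬bxu | no ¬rzu = contradiction (xw-or-zw′ (adj? x u) (adj? w u)) λ
      -- As `u` lies outside the blue ball around `x`, both `xu` and `wu` are red, which gives a red
      -- path from `x` to `w`. The other case is the same with colours exchanged.
      { (inj₁ (xu , wu)) → ¬rxw (near-path (red-edge ¬bxu xu) (edge-sym c (red-wu wu)))
      ; (inj₂ (zu , w′u)) → ¬bzw′ (near-path (blue-edge ¬rzu zu) (edge-sym c (blue-w′u w′u)))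
      }
      where
      x≢u : x ≢ u
      x≢u refl = ¬bxu (inj₁ refl)
      z≢u : z ≢ u
      z≢u refl = ¬rzu (inj₁ refl)
      w≢u : w ≢ u
      w≢u refl = ¬bxu (near-edge xw)
      w′≢u : w′ ≢ u
      w′≢u refl = ¬rzu (near-edge zw′)
      z≢w : z ≢ w
      z≢w z≡w = ¬rzw (inj₁ z≡w)
      x≢w′ : x ≢ w′
      x≢w′ x≡w′ = ¬bxw′ (inj₁ x≡w′)
      w≢w′ : w ≢ w′
      w≢w′ refl = ¬bxw′ (near-edge xw)

      red-wu : Adj G w u → Edge c red w u
      red-wu wu = [ id , (λ e → contradiction (near-path xw e) ¬bxu) ] (red⊎blue wu)

      blue-w′u : Adj G w′ u → Edge c blue w′ u
      blue-w′u w′u = [ (λ e → contradiction (near-path zw′ e) ¬rzu) , id ] (red⊎blue w′u)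

      -- `x` and `w` are opposite corners of the 4-cycle in the complement, so each is nonadjacent
      -- to both `z` and `w′`. If `u` misses either of them, it is therefore adjacent to both `z`
      -- and `w′`.
      xw-or-zw′ : Dec (Adj G x u) → Dec (Adj G w u) →
        (Adj G x u × Adj G w u) ⊎ (Adj G z u × Adj G w′ u)
      xw-or-zw′ (yes xu) (yes wu) = inj₁ (xu , wu)
      xw-or-zw′ (no x≁u) _ = inj₂
        ( nonEdge⇒adjacent x≁z x≢z x≢u z≢u x≁u
        , nonEdge⇒adjacent (w′≁x ∘ Adj-sym) x≢w′ x≢u w′≢u x≁u )
      xw-or-zw′ (yes _) (no w≁u) = inj₂
        ( nonEdge⇒adjacent (z≁w ∘ Adj-sym) (z≢w ∘ ≡.sym) w≢u z≢u w≁u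
        , nonEdge⇒adjacent w≁w′ w≢w′ w≢u w′≢u w≁u )

    -- The edge `xw` breaks the symmetry between `x` and `z`. It must be blue, and it excludes in
    -- turn the edges `zw`, `xw′` and `ww′`; the absence of `xw′` makes `zw′` an edge, which must be
    -- red.
    missed⇒covers : ∀ {x z w w′} → ¬ Near c red x z → ¬ Near c blue x z →
      ¬ Near c red x w → ¬ Near c red z w → ¬ Near c blue x w′ → ¬ Near c blue z w′ →
      Adj G x w → Covers c blue x red z
    missed⇒covers {x} {z} {w} {w′} ¬rxz ¬bxz ¬rxw ¬rzw ¬bxw′ ¬bzw′ x~w =
      cycle⇒covers x≁z z≁w w≁w′ (x≁w′ ∘ Adj-sym) (¬rxz ∘ inj₁) xw zw′ ¬rxw ¬rzw ¬bxw′ ¬bzw′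
      where
      x≁z : ¬ Adj G x z
      x≁z = far⇒nonEdge ¬rxz ¬bxz

      xw : Edge c blue x w
      xw = blue-edge ¬rxw x~w

      z≁w : ¬ Adj G z w
      z≁w zw = ¬bxz (near-path xw (edge-sym c (blue-edge ¬rzw zw)))

      w≢w′ : w ≢ w′
      w≢w′ refl = ¬bxw′ (near-edge xw)

      ¬blue-ww′ : ¬ Edge c blue w w′
      ¬blue-ww′ e = ¬bxw′ (near-path xw e)

      -- An edge `xw′` would be red, so `zw′` could not be an edge, as it would complete a red path
      -- from `x` to `z`. Then `z` misses both `w` and `w′`, which makes `ww′` an edge: if red, it
      -- brings `w` into the red ball around `x`; if blue, it brings `w′` into the blue one.
      x≁w′ : ¬ Adj G x w′
      x≁w′ x~w′ = [ (λ e → ¬rxw (near-path xw′ (edge-sym c e))) , ¬blue-ww′ ] (red⊎blue w~w′)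
        where
        xw′ : Edge c red x w′
        xw′ = red-edge ¬bxw′ x~w′

        z≁w′ : ¬ Adj G z w′
        z≁w′ zw′ = ¬rxz (near-path xw′ (edge-sym c (red-edge ¬bzw′ zw′)))

        w~w′ : Adj G w w′
        w~w′ = nonEdge⇒adjacent z≁w (¬rzw ∘ inj₁) (¬bzw′ ∘ inj₁) w≢w′ z≁w′

      zw′ : Edge c red z w′
      zw′ = red-edge ¬bzw′ (nonEdge⇒adjacent x≁z (¬rxz ∘ inj₁) (¬bxw′ ∘ inj₁) (¬bzw′ ∘ inj₁) x≁w′)

      -- A red edge would put `w` in the red ball around `z` through `w′`, and a blue one would put
      -- `w′` in the blue ball around `x` through `w`.
      w≁w′ : ¬ Adj G w w′
      w≁w′ ww′ = [ (λ e → ¬rzw (near-path zw′ (edge-sym c e))) , ¬blue-ww′ ] (red⊎blue ww′)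

    coverFrom : Fin n → HasCover c 4 4
    coverFrom x with covers⊎missed c red x blue x
    ... | inj₁ covers = covers⇒hasCover c covers
    ... | inj₂ (z , ¬rxz , ¬bxz)
      with covers⊎missed c red x red z | covers⊎missed c blue x blue z
    ...   | inj₁ covers | _ = covers⇒hasCover c covers
    ...   | inj₂ _ | inj₁ covers = covers⇒hasCover c covers
    ...   | inj₂ (w , ¬rxw , ¬rzw) | inj₂ (w′ , ¬bxw′ , ¬bzw′) with adj? x w
    ...     | yes xw = covers⇒hasCover c (missed⇒covers ¬rxz ¬bxz ¬rxw ¬rzw ¬bxw′ ¬bzw′ xw)
    -- Now `w` is adjacent to `z` instead, so `x` and `z` exchange roles.
    ...     | no x≁w = covers⇒hasCover c
      (missed⇒covers (¬rxz ∘ near-sym c) (¬bxz ∘ near-sym c) ¬rzw ¬rxw ¬bzw′ ¬bxw′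
        (nonEdge⇒adjacent (far⇒nonEdge ¬rxz ¬bxz) (¬rxz ∘ inj₁) (¬rxw ∘ inj₁) (¬rzw ∘ inj₁) x≁w))

-- From covers by two balls to the bound on `f`.

hasCover-4-4 : ∀ {n} (G : Graph n) → IndependenceNumber G 2 →
  (c : Colouring G 2) → HasCover c 4 4
-- An independent set of size 2 rules out the empty graph, so there is a vertex to start from.
hasCover-4-4 {zero}  G (([] , _ , ()) , _) c
hasCover-4-4 {suc n} G (_ , α≤2) c = coverFrom α≤2 c zero

hasCover⇒hasConnectedCover : ∀ {n r d} {G : Graph n} (c : Colouring G r) →
  HasCover c d d → HasConnectedCover c 2 d
hasCover⇒hasConnectedCover c (H₁ , H₂ , (mono₁ , diam₁) , (mono₂ , diam₂) , covers) =
  (λ { zero → H₁ ; (suc zero) → H₂ }) ,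
  (λ { zero       → mono₁ , diameter⇒connected H₁ diam₁ , diam₁
     ; (suc zero) → mono₂ , diameter⇒connected H₂ diam₂ , diam₂ }) ,
  λ v → [ (zero ,_) , (suc zero ,_) ]′ (covers v)

coverBound-4 : CoverBound 2 2 4
-- The required number of subgraphs, `(2 ∸ 1) * 2`, computes to 2.
coverBound-4 G α≡2 c = hasCover⇒hasConnectedCover c (hasCover-4-4 G α≡2 c)

theorem2p1 : (∀ {n : ℕ} (G : Graph n) → IndependenceNumber G 2 →
    (c : Colouring G 2) → HasCover c 4 4)
    × F≤ 2 2 4
theorem2p1 = hasCover-4-4 , λ ¬f → ¬¬least (CoverBound 2 2) 4 coverBound-4
  λ (d , bound , minimal) → ¬f (d , (bound , minimal) , minimal 4 coverBound-4)
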